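{- Let $G$ be an oriented graph and let $a,b$ be positive integers. Then $\chi^*_o(G) \leq \frac{a}{b}$ if and only if there exist a positive integer $c$ and a consistent sub-orientation $\overrightarrow{KG}_{ac,bc}$ of the Kneser graph $KG_{ac,bc}$ such that $G$ admits a homomorphism to $\overrightarrow{KG}_{ac,bc}$.
   Context: An oriented graph is a finite directed graph with no directed cycle of length 1 or 2. For a set $S$ of $k$ colors let $P_b(S)$ be the set of $b$-element subsets of $S$. A $b$-fold oriented $k$-coloring of an oriented graph $G$ is a map $f: V(G) \to P_b(S)$ with $|S|=k$ such that (i) $f(x)\cap f(y)=\emptyset$ for every arc $xy$, and (ii) for all arcs $xy, zw$, $f(x)\cap f(w)\neq\emptyset$ implies $f(y)\cap f(z)=\emptyset$. The $b$-fold oriented chromatic number $\chi^b_o(G)$ is the minimum $k$ such that $G$ admits a $b$-fold oriented $k$-coloring, and the fractional oriented chromatic number is $\chi^*_o(G)=\lim_{b\to\infty}\chi^b_o(G)/b=\inf_{b\geq 1}\chi^b_o(G)/b$. A homomorphism of an oriented graph $G$ to an oriented graph $H$ is a map $f:V(G)\to V(H)$ such that $f(x)f(y)$ is an arc of $H$ whenever $xy$ is an arc of $G$. The Kneser graph $KG_{a,b}$ has the $b$-subsets of an $a$-set as vertices, two being adjacent iff they are disjoint. A consistent sub-orientation of $KG_{a,b}$ is an oriented graph $\overrightarrow{KG}_{a,b}$ whose underlying graph is a subgraph of $KG_{a,b}$ and such that for any two arcs $xy$ and $wz$, $x\cap z\neq\emptyset$ implies $y\cap w=\emptyset$. -}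

module Defs where

open import Level using (0ℓ)
open import Data.Empty using (⊥-elim)
open import Data.Fin using (Fin; zero; suc)
open import Data.Fin.Properties using (any?; all?)
open import Data.Fin.Subset using (Subset; inside; outside; _∈_; _∩_; ∣_∣; ⊤; ⊥; Nonempty; Empty)
open import Data.Fin.Subset.Properties using (∉⊥; ∣⊥∣≡0; ∣⊤∣≡n; nonempty?; anySubset?; x∈p∩q⁻)
open import Data.Integer using (+_)
open import Data.Nat using (ℕ; zero; suc; z≤n; s≤s; _+_; _*_; _≤_; _≟_)
open import Data.Nat.Properties using (≡-irrelevant; +-identityʳ)
open import Data.Product using (Σ; ∃; _×_; _,_; proj₁; proj₂)
open import Data.Rational.Unnormalised as ℚᵘ using (ℚᵘ; 0ℚᵘ; 1ℚᵘ; _/_)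
import Data.Rational.Unnormalised.Properties as ℚᵘ
open import Data.Sum using (_⊎_; inj₁; inj₂)
open import Data.Vec using ([]; _∷_; _++_; here; there)
open import Data.Vec.Functional as Vector using (Vector)
open import Function using (_∘_; Injective)
open import Relation.Binary.Core using (Rel)
open import Relation.Binary.Definitions using (Decidable)
open import Relation.Binary.PropositionalEquality using (_≡_; refl; sym; trans; cong; cong₂; subst; _≗_)
open import Relation.Nullary using (¬_; Dec; yes; no; ¬?; _×-dec_; _→-dec_)
open import Relation.Nullary.Decidable using (map′)
import Relation.Unary as U

record Graph : Set₁ where
  field
    Vertex : Set
    Adj    : Rel Vertex 0ℓ

record OrientedGraph : Set₁ where
  field
    order    : ℕ
  Vertex : Set
  Vertex = Fin order
  field
    Arc      : Rel Vertex 0ℓ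
    arc?     : Decidable Arc
    no-loop  : ∀ {x} → ¬ Arc x x
    no-2cycle : ∀ {x y} → Arc x y → ¬ Arc y x

open OrientedGraph

underlying : OrientedGraph → Graph
underlying G = record { Vertex = Vertex G ; Adj = λ x y → Arc G x y ⊎ Arc G y x }

Homomorphism : OrientedGraph → OrientedGraph → Set
Homomorphism G H =
  Σ (Vertex G → Vertex H) λ f → ∀ {x y} → Arc G x y → Arc H (f x) (f y)

-- G is a subgraph of H up to renaming the vertices of G along ι.
record SubgraphEmbedding (G H : Graph) : Set where
  private
    module G = Graph G
    module H = Graph H
  field
    ι         : G.Vertex → H.Vertex
    injective : Injective _≡_ _≡_ ι
    adjacent  : ∀ {x y} → G.Adj x y → H.Adj (ι x) (ι y)

-- The b-element subsets of a k-element set.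
𝒫 : ℕ → ℕ → Set
𝒫 b k = Σ (Subset k) λ p → ∣ p ∣ ≡ b

module _ {b k : ℕ} where

  Meets : Rel (𝒫 b k) 0ℓ
  Meets p q = Nonempty (proj₁ p ∩ proj₁ q)

  Disjoint : Rel (𝒫 b k) 0ℓ
  Disjoint p q = Empty (proj₁ p ∩ proj₁ q)

KG : ℕ → ℕ → Graph
KG a b = record { Vertex = 𝒫 b a ; Adj = Disjoint }

record ConsistentSubOrientation (a b : ℕ) : Set₁ where
  field
    graph     : OrientedGraph
    embedding : SubgraphEmbedding (underlying graph) (KG a b)
  open SubgraphEmbedding embedding public
  field
    consistent : ∀ {x y w z} → Arc graph x y → Arc graph w z →
                 Meets (ι x) (ι z) → Disjoint (ι y) (ι w)

record IsColoring (G : OrientedGraph) {b k : ℕ} (f : Vertex G → 𝒫 b k) : Set where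
  field
    proper     : ∀ {x y} → Arc G x y → Disjoint (f x) (f y)
    consistent : ∀ {x y z w} → Arc G x y → Arc G z w →
                 Meets (f x) (f w) → Disjoint (f y) (f z)

Colorable : OrientedGraph → (b k : ℕ) → Set
Colorable G b k = ∃ λ (f : Vertex G → 𝒫 b k) → IsColoring G f

IsMinimum : (ℕ → Set) → ℕ → Set
IsMinimum P k = P k × (∀ j → P j → k ≤ j)

-- The b-fold oriented chromatic number is well defined: colorability is
-- decidable, and giving the vertices pairwise disjoint blocks of b colors
-- shows that some number of colors suffices.

private

  minimum : ∀ {P : ℕ → Set} → U.Decidable P → ∀ m → P m → ∃ (IsMinimum P)
  minimum P? zero p = zero , p , λ _ _ → z≤n
  minimum {P} P? (suc m) p with P? zero
  ... | yes p₀ = zero , p₀ , λ _ _ → z≤n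
  ... | no ¬p₀ with minimum {P ∘ suc} (P? ∘ suc) m p
  ...   | k , pk , k-min = suc k , pk , λ
          { zero    p₀ → ⊥-elim (¬p₀ p₀)
          ; (suc j) pj → s≤s (k-min j pj)
          }

  Searchable : Set → Set₁
  Searchable A = ∀ {P : A → Set} → U.Decidable P → Dec (∃ P)

  search-𝒫 : ∀ {b k} → Searchable (𝒫 b k)
  search-𝒫 {b} {k} {P} P? =
    map′ (λ (p , e , h) → (p , e) , h) (λ ((p , e) , h) → p , e , h) (anySubset? Q?)
    where
    Q? : U.Decidable (λ (p : Subset k) → ∃ λ (e : ∣ p ∣ ≡ b) → P (p , e))
    Q? p with ∣ p ∣ ≟ b
    ... | no ≢b = no λ (e , _) → ≢b e
    ... | yes e = map′ (e ,_)
      (λ (e′ , h) → subst (λ e → P (p , e)) (≡-irrelevant e′ e) h) (P? (p , e))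

  search-Vector : ∀ {A : Set} → Searchable A → ∀ n {P : Vector A n → Set} →
                  (∀ {f g} → f ≗ g → P f → P g) → U.Decidable P → Dec (∃ P)
  search-Vector search zero resp P? =
    map′ (Vector.[] ,_) (λ (f , h) → resp (λ ()) h) (P? Vector.[])
  search-Vector search (suc n) resp P? =
    map′ (λ (x , f , h) → (x Vector.∷ f) , h)
         (λ (f , h) → f zero , f ∘ suc , resp (λ { zero → refl ; (suc _) → refl }) h)
         (search λ x → search-Vector search n
           (λ f≗g → resp λ { zero → refl ; (suc i) → f≗g i })
           (λ f → P? (x Vector.∷ f)))

  isColoring-resp : ∀ G {b k} {f g : Vertex G → 𝒫 b k} → f ≗ g →
                    IsColoring G f → IsColoring G g
  isColoring-resp G {f = f} {g} f≗g c = record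
    { proper     = λ {x} {y} xy → disjoint x y (proper xy)
    ; consistent = λ {x} {y} {z} {w} xy zw m →
        disjoint y z (consistent xy zw (meets x w m))
    }
    where
    open IsColoring c
    meets : ∀ x y → Meets (g x) (g y) → Meets (f x) (f y)
    meets x y m rewrite f≗g x | f≗g y = m
    disjoint : ∀ x y → Disjoint (f x) (f y) → Disjoint (g x) (g y)
    disjoint x y d m = d (meets x y m)

  isColoring? : ∀ G {b k} → U.Decidable (IsColoring G {b} {k})
  isColoring? G f =
    map′ (λ (p , c) → record { proper = p _ _ ; consistent = c _ _ _ _ })
         (λ c → (λ _ _ → IsColoring.proper c) , (λ _ _ _ _ → IsColoring.consistent c))
         ((all? λ x → all? λ y → arc? G x y →-dec disjoint? x y)
          ×-dec
          (all? λ x → all? λ y → all? λ z → all? λ w →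
            arc? G x y →-dec arc? G z w →-dec meets? x w →-dec disjoint? y z))
    where
    meets?    = λ x y → nonempty? (proj₁ (f x) ∩ proj₁ (f y))
    disjoint? = λ x y → ¬? (meets? x y)

  ∣++∣ : ∀ {m n} (p : Subset m) (q : Subset n) → ∣ p ++ q ∣ ≡ ∣ p ∣ + ∣ q ∣
  ∣++∣ []            q = refl
  ∣++∣ (inside  ∷ p) q = cong suc (∣++∣ p q)
  ∣++∣ (outside ∷ p) q = ∣++∣ p q

  ++-∩ : ∀ {m n} (p p′ : Subset m) (q q′ : Subset n) →
         Nonempty ((p ++ q) ∩ (p′ ++ q′)) → Nonempty (p ∩ p′) ⊎ Nonempty (q ∩ q′)
  ++-∩ []      []        q q′ m = inj₂ m
  ++-∩ (s ∷ p) (s′ ∷ p′) q q′ (suc i , there h) with ++-∩ p p′ q q′ (i , h)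
  ... | inj₁ (j , h′) = inj₁ (suc j , there h′)
  ... | inj₂ m        = inj₂ m
  ++-∩ (inside ∷ p) (inside ∷ p′) q q′ (zero , here) = inj₁ (zero , here)

  block : ∀ n b → Fin n → 𝒫 b (n * b)
  block (suc n) b zero =
    ⊤ {b} ++ ⊥ {n * b} ,
    trans (∣++∣ (⊤ {b}) ⊥) (trans (cong₂ _+_ (∣⊤∣≡n b) (∣⊥∣≡0 (n * b))) (+-identityʳ b))
  block (suc n) b (suc i) =
    ⊥ {b} ++ proj₁ (block n b i) ,
    trans (∣++∣ (⊥ {b}) (proj₁ (block n b i))) (cong₂ _+_ (∣⊥∣≡0 b) (proj₂ (block n b i)))

  block-meets : ∀ n b i j → Meets (block n b i) (block n b j) → i ≡ j
  block-meets (suc n) b zero zero m = refl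
  block-meets (suc n) b zero (suc j) m
    with ++-∩ (⊤ {b}) ⊥ ⊥ (proj₁ (block n b j)) m
  ... | inj₁ (_ , h) = ⊥-elim (∉⊥ (proj₂ (x∈p∩q⁻ (⊤ {b}) ⊥ h)))
  ... | inj₂ (_ , h) = ⊥-elim (∉⊥ (proj₁ (x∈p∩q⁻ ⊥ (proj₁ (block n b j)) h)))
  block-meets (suc n) b (suc i) zero m
    with ++-∩ (⊥ {b}) ⊤ (proj₁ (block n b i)) ⊥ m
  ... | inj₁ (_ , h) = ⊥-elim (∉⊥ (proj₁ (x∈p∩q⁻ (⊥ {b}) ⊤ h)))
  ... | inj₂ (_ , h) = ⊥-elim (∉⊥ (proj₂ (x∈p∩q⁻ (proj₁ (block n b i)) ⊥ h)))
  block-meets (suc n) b (suc i) (suc j) m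
    with ++-∩ (⊥ {b}) ⊥ (proj₁ (block n b i)) (proj₁ (block n b j)) m
  ... | inj₁ (_ , h) = ⊥-elim (∉⊥ (proj₁ (x∈p∩q⁻ (⊥ {b}) ⊥ h)))
  ... | inj₂ m′      = cong suc (block-meets n b i j m′)

colorable? : ∀ G b k → Dec (Colorable G b k)
colorable? G b k =
  search-Vector search-𝒫 (order G) (isColoring-resp G) (isColoring? G)

blockColorable : ∀ G b → Colorable G b (order G * b)
blockColorable G b = block (order G) b , record
  { proper     = λ {x} {y} xy m →
      no-loop G (subst (Arc G x) (sym (block-meets _ b x y m)) xy)
  ; consistent = λ {x} {y} {z} {w} xy zw m m′ →
      contra (block-meets _ b x w m) (block-meets _ b y z m′) xy zw
  }
  where
  contra : ∀ {x y z w} → x ≡ w → y ≡ z → Arc G x y → ¬ Arc G z w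
  contra refl refl = no-2cycle G

leastColors : ∀ G b → ∃ (IsMinimum (Colorable G b))
leastColors G b = minimum (colorable? G b) (order G * b) (blockColorable G b)

χ[_] : ℕ → OrientedGraph → ℕ
χ[ b ] G = proj₁ (leastColors G b)

χ-isMinimum : ∀ b G → IsMinimum (Colorable G b) (χ[ b ] G)
χ-isMinimum b G = proj₂ (leastColors G b)

-- Upper reals: a real x is represented by its upper Dedekind cut, with U q
-- standing for "x < q".  Classically these are exactly the real numbers;
-- constructively, unlike two-sided cuts or Cauchy sequences, they are closed
-- under infima of inhabited families bounded below.

record ℝᵘ : Set₁ where
  field
    U         : ℚᵘ → Set
    inhabited : ∃ U
    bounded   : ∃ λ l → ∀ {q} → U q → l ℚᵘ.< q
    upward    : ∀ {q r} → U q → q ℚᵘ.≤ r → U r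
    rounded   : ∀ {q} → U q → ∃ λ p → p ℚᵘ.< q × U p

infix 4 _≤ℝᵘ_
_≤ℝᵘ_ : Rel ℝᵘ 0ℓ
x ≤ℝᵘ y = ∀ q → ℝᵘ.U y q → ℝᵘ.U x q

private
  <+1 : ∀ q → q ℚᵘ.< q ℚᵘ.+ 1ℚᵘ
  <+1 q = ℚᵘ.<-respˡ-≃ (ℚᵘ.+-identityʳ q)
            (ℚᵘ.+-monoʳ-< q (ℚᵘ.positive⁻¹ 1ℚᵘ))

fromℚ : ℚᵘ → ℝᵘ
fromℚ p = record
  { U         = λ q → p ℚᵘ.< q
  ; inhabited = p ℚᵘ.+ 1ℚᵘ , <+1 p
  ; bounded   = p , λ p<q → p<q
  ; upward    = ℚᵘ.<-≤-trans
  ; rounded   = λ p<q → let (m , p<m , m<q) = ℚᵘ.<-dense p<q in m , m<q , p<m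
  }

inf : (f : ℕ → ℚᵘ) (l : ℚᵘ) → (∀ n → l ℚᵘ.≤ f n) → ℝᵘ
inf f l l≤f = record
  { U         = λ q → ∃ λ n → f n ℚᵘ.< q
  ; inhabited = f 0 ℚᵘ.+ 1ℚᵘ , 0 , <+1 (f 0)
  ; bounded   = l , λ (n , fn<q) → ℚᵘ.≤-<-trans (l≤f n) fn<q
  ; upward    = λ (n , fn<q) q≤r → n , ℚᵘ.<-≤-trans fn<q q≤r
  ; rounded   = λ (n , fn<q) →
      let (m , fn<m , m<q) = ℚᵘ.<-dense fn<q in m , m<q , n , fn<m
  }

-- The infimum over b = suc n ≥ 1 of χ[ b ] G / b.
χ* : OrientedGraph → ℝᵘ
χ* G = inf (λ n → + χ[ suc n ] G / suc n) 0ℚᵘ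
           (λ n → ℚᵘ.nonNegative⁻¹ (+ χ[ suc n ] G / suc n))

-- A coloring is a multiset of pairwise compatible color classes covering every
-- vertex equally often.  For the multisets satisfying these covering equations,
-- intersecting the cone of all multisets with one hyperplane at a time produces
-- finitely many generators: every solution has a positive multiple which is a sum
-- of generators contained in it, so generators of colorings are colorings.  Hence
-- either some generator has ratio at most a / b, or the ratios of all colorings are
-- bounded away from a / b, i.e. the infimum is attained.  Blowing up and padding
-- such a coloring gives a c colors with b c colors per vertex, and its image is the
-- required sub-orientation.
module Submission where

open import Defs
open import Data.Bool as Bool using (Bool; true; false)
open import Data.Fin as Fin using (Fin; zero; suc)
open import Data.Fin.Properties using (any?; all?)
open import Data.Fin.Subset using (Subset; inside; outside; _∩_; ∣_∣; Nonempty)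
  renaming (_∈_ to _∈ₛ_; ⊥ to ∅)
open import Data.Fin.Subset.Properties using (∉⊥; _∈?_; nonempty?; x∈p∩q⁺; x∈p∩q⁻; Empty-unique; ∣⊥∣≡0; ∩-idem; ∩-comm)
open import Data.Integer using (+_)
import Data.Integer as ℤ
import Data.Integer.Properties as ℤ
open import Data.List using (List; []; _∷_; [_]; _++_; map; filter; concat; replicate; length; lookup; tabulate; allFin; cartesianProductWith; deduplicate)
open import Data.List.Membership.Propositional using (_∈_; find)
open import Data.List.Membership.Propositional.Properties
  using (∈-filter⁺; ∈-filter⁻; ∈-++⁺ˡ; ∈-++⁺ʳ; ∈-cartesianProductWith⁺; ∈-map⁺; ∈-lookup; ∈-tabulate⁺; ∈-allFin; ∈-deduplicate⁺)
open import Data.List.Properties using (map-++; tabulate-lookup; length-tabulate; filter-accept; filter-reject)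
open import Data.List.Relation.Binary.Subset.Propositional using (_⊆_)
open import Data.List.Relation.Unary.All as All using (All; []; _∷_)
import Data.List.Relation.Unary.All.Properties as All
open import Data.List.Relation.Unary.Any as Any using (here; there; index)
open import Data.List.Relation.Unary.Any.Properties using (lookup-index)
open import Data.List.Relation.Unary.AllPairs using (_∷_)
open import Data.List.Relation.Unary.Unique.Propositional using (Unique)
import Data.List.Relation.Unary.Unique.DecPropositional.Properties as Unique
open import Data.Nat using (ℕ; zero; suc; _+_; _*_; _∸_; _≤_; _<_; z≤n; s≤s; NonZero; _≟_; _<?_; _≤?_; ≢-nonZero⁻¹)
open import Data.Nat.ListAction using (sum)
open import Data.Nat.ListAction.Properties using (sum-++)
open import Data.Nat.Properties
open import Data.Nat.Tactic.RingSolver using (solve-∀)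
open import Data.Product using (Σ; ∃; ∃₂; _×_; _,_; proj₁; proj₂)
open import Data.Rational.Unnormalised using (_/_; *<*; *≤*)
import Data.Rational.Unnormalised as ℚ
import Data.Rational.Unnormalised.Properties as ℚ
open import Data.Sum using (_⊎_; inj₁; inj₂)
open import Data.Unit using (tt)
import Data.Vec as Vec
import Data.Vec.Properties as Vec
open import Function using (_∘_; const; Injective)
open import Function.Bundles using (_⇔_; mk⇔)
open import Relation.Binary.Definitions using (tri<; tri≈; tri>; DecidableEquality)
open import Relation.Binary.PropositionalEquality hiding ([_])
open import Relation.Nullary using (¬_; Dec; yes; no; contradiction; _×-dec_; _→-dec_; ¬?)
import Relation.Unary as U

open OrientedGraph

-- Multisets as lists, and sums over them

module _ {A : Set} where

  total : (A → ℕ) → List A → ℕ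
  total F xs = sum (map F xs)

  total-++ : ∀ F xs ys → total F (xs ++ ys) ≡ total F xs + total F ys
  total-++ F xs ys = trans (cong sum (map-++ F xs ys)) (sum-++ (map F xs) (map F ys))

  infixr 8 _·_
  _·_ : ℕ → List A → List A
  n · xs = concat (replicate n xs)

  total-· : ∀ F n xs → total F (n · xs) ≡ n * total F xs
  total-· F zero    xs = refl
  total-· F (suc n) xs =
    trans (total-++ F xs (n · xs)) (cong (_+_ (total F xs)) (total-· F n xs))

  All-· : ∀ {P : A → Set} n {xs} → All P xs → All P (n · xs)
  All-· n pxs = All.concat⁺ (All.replicate⁺ n pxs)

  total≡length : ∀ xs → total (const 1) xs ≡ length xs
  total≡length []       = refl
  total≡length (x ∷ xs) = cong suc (total≡length xs)

  ≤total : ∀ F {x xs} → x ∈ xs → F x ≤ total F xs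
  ≤total F (here refl) = m≤m+n _ _
  ≤total F (there x∈)  = ≤-trans (≤total F x∈) (m≤n+m _ _)

  total-positive : ∀ F {xs} → All (λ x → 0 < F x) xs → total F xs ≡ 0 → xs ≡ []
  total-positive F []       _ = refl
  total-positive F {x ∷ _} (px ∷ _) e =
    contradiction (m+n≡0⇒m≡0 (F x) e) (>⇒≢ px)

  total-cong : ∀ {F G xs} → All (λ x → F x ≡ G x) xs → total F xs ≡ total G xs
  total-cong []         = refl
  total-cong (eq ∷ eqs) = cong₂ _+_ eq (total-cong eqs)

  total-∸ : ∀ {F G xs} → All (λ x → G x ≤ F x) xs →
            total F xs ≡ total G xs + total (λ x → F x ∸ G x) xs
  total-∸ [] = refl
  total-∸ {F} {G} {x ∷ xs} (le ∷ les) = begin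
    F x + total F xs
      ≡⟨ cong₂ _+_ (sym (m+[n∸m]≡n le)) (total-∸ les) ⟩
    G x + (F x ∸ G x) + (total G xs + total (λ x → F x ∸ G x) xs)
      ≡⟨ +-interchange (G x) _ _ _ ⟩
    G x + total G xs + (F x ∸ G x + total (λ x → F x ∸ G x) xs) ∎
    where
    open ≡-Reasoning
    +-interchange : ∀ a b c d → a + b + (c + d) ≡ a + c + (b + d)
    +-interchange = solve-∀

  module _ (P Q : A → ℕ) where

    equal?   = λ x → P x ≟ Q x
    greater? = λ x → Q x <? P x
    less?    = λ x → P x <? Q x

    total-split : ∀ F xs → total F xs ≡
      total F (filter equal? xs) + (total F (filter greater? xs) + total F (filter less? xs))
    total-split F [] = refl
    total-split F (x ∷ xs) with <-cmp (P x) (Q x)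
    ... | tri< lt ne ngt
      rewrite filter-reject equal? {xs = xs} ne | filter-reject greater? {xs = xs} ngt
            | filter-accept less? {xs = xs} lt
      = trans (cong (_+_ (F x)) (total-split F xs))
          (move (F x) (total F (filter equal? xs)) (total F (filter greater? xs))
            (total F (filter less? xs)))
      where move : ∀ f e g l → f + (e + (g + l)) ≡ e + (g + (f + l))
            move = solve-∀
    ... | tri≈ nlt eq ngt
      rewrite filter-accept equal? {xs = xs} eq | filter-reject greater? {xs = xs} ngt
            | filter-reject less? {xs = xs} nlt
      = trans (cong (_+_ (F x)) (total-split F xs))
          (sym (+-assoc (F x) (total F (filter equal? xs)) _))
    ... | tri> nlt ne gt
      rewrite filter-reject equal? {xs = xs} ne | filter-accept greater? {xs = xs} gt
            | filter-reject less? {xs = xs} nlt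
      = trans (cong (_+_ (F x)) (total-split F xs))
          (move (F x) (total F (filter equal? xs)) (total F (filter greater? xs))
            (total F (filter less? xs)))
      where move : ∀ f e g l → f + (e + (g + l)) ≡ e + ((f + g) + l)
            move = solve-∀

  -- In the double sum each factor's weight separates from the other factor's value. With `w` and
  -- `u` as deficit and excess, this evaluates the sum of all combinations of two lists of
  -- generators.
  total-cartesianProductWith : ∀ {V u w : A → ℕ} {_⊗_ : A → A → A} →
    (∀ x y → V (x ⊗ y) ≡ w y * V x + u x * V y) → ∀ xs ys →
    total V (cartesianProductWith _⊗_ xs ys) ≡ total w ys * total V xs + total u xs * total V ys
  total-cartesianProductWith {V} {u} {w} {_⊗_} V⊗ = outer
    where
    inner : ∀ x ys → total V (map (x ⊗_) ys) ≡ total w ys * V x + u x * total V ys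
    inner x []       = sym (*-zeroʳ (u x))
    inner x (y ∷ ys) = trans (cong₂ _+_ (V⊗ x y) (inner x ys)) 
      (ring (w y) (V x) (u x) (V y) (total w ys) (total V ys))
      where ring : ∀ wy Vx ux Vy W V → (wy * Vx + ux * Vy) + (W * Vx + ux * V)
                 ≡ (wy + W) * Vx + ux * (Vy + V)
            ring = solve-∀
    outer : ∀ xs ys → total V (cartesianProductWith _⊗_ xs ys)
          ≡ total w ys * total V xs + total u xs * total V ys
    outer []       ys = sym (trans (+-identityʳ _) (*-zeroʳ (total w ys)))
    outer (x ∷ xs) ys = trans (total-++ V (map (x ⊗_) ys) _)
      (trans (cong₂ _+_ (inner x ys) (outer xs ys)) 
        (ring (total w ys) (V x) (u x) (total V ys) (total V xs) (total u xs)))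
      where ring : ∀ W Vx ux T Vs us → (W * Vx + ux * T) + (W * Vs + us * T)
                 ≡ W * (Vx + Vs) + (ux + us) * T
            ring = solve-∀

-- Generators of the multisets solving linear equations

module _ {A : Set} where

  total-singletons : ∀ F (ys : List A) → total (total F) (map [_] ys) ≡ total F ys
  total-singletons F []       = refl
  total-singletons F (y ∷ ys) = cong₂ _+_ (+-identityʳ (F y)) (total-singletons F ys)

  -- A multiset ys is identified with its values total F ys, so that the last
  -- condition says that z sums up to m copies of ys.
  Decomposition : List (List A) → List A → Set
  Decomposition gens ys = ∃₂ λ m z → NonZero m ×
    All (λ g → g ∈ gens × g ⊆ ys) z × (∀ F → total (total F) z ≡ m * total F ys)

  -- A linear form `p - q` set to zero, split in two because weights are natural numbers.
  Equation : Set
  Equation = (A → ℕ) × (A → ℕ)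

  Solves : List A → Equation → Set
  Solves ys (p , q) = total p ys ≡ total q ys

  module Cut (p q : A → ℕ) where

    P Q up down : List A → ℕ
    P = total p
    Q = total q
    up   g = P g ∸ Q g
    down g = Q g ∸ P g

    -- For `g` above the hyperplane and `h` below it, the weights make the excess `up g` of the one
    -- cancel the deficit `down h` of the other.
    combine : List A → List A → List A
    combine g h = down h · g ++ up g · h

    total-combine : ∀ F g h → total F (combine g h) ≡ down h * total F g + up g * total F h
    total-combine F g h = trans (total-++ F (down h · g) _)
      (cong₂ _+_ (total-· F (down h) g) (total-· F (up g) h))

    zeros positives negatives : List (List A) → List (List A)
    zeros     = filter (equal? P Q)
    positives = filter (greater? P Q)
    negatives = filter (less? P Q)

    -- One step of the double description method for cones: generators on the hyperplane are kept,
    -- and the others are replaced, up to scaling, by the points where segments from the positive to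
    -- the negative side cross it.
    cut : List (List A) → List (List A)
    cut gens = zeros gens ++ cartesianProductWith combine (positives gens) (negatives gens)

    combine-solves : ∀ {g h} → Q g < P g → P h < Q h → Solves (combine g h) (p , q)
    combine-solves {g} {h} g⁺ h⁻ = begin
      P (combine g h)                                ≡⟨ total-combine p g h ⟩
      down h * P g + up g * P h                      ≡⟨ cong (λ t → down h * t + up g * P h) (m+[n∸m]≡n (<⇒≤ g⁺)) ⟨
      down h * (Q g + up g) + up g * P h             ≡⟨ ring (down h) (Q g) (up g) (P h) ⟩
      down h * Q g + up g * (P h + down h)           ≡⟨ cong (λ t → down h * Q g + up g * t) (m+[n∸m]≡n (<⇒≤ h⁻)) ⟩
      down h * Q g + up g * Q h                      ≡⟨ total-combine q g h ⟨
      Q (combine g h)                                ∎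
      where
      open ≡-Reasoning
      ring : ∀ d Qg u Ph → d * (Qg + u) + u * Ph ≡ d * Qg + u * (Ph + d)
      ring = solve-∀

    combine-preserves : ∀ {g h} e → Solves g e → Solves h e → Solves (combine g h) e
    combine-preserves {g} {h} (r , s) ge he = trans (total-combine r g h)
      (trans (cong₂ (λ x y → down h * x + up g * y) ge he) (sym (total-combine s g h)))

    cut-solves : ∀ {es gens} → All (λ g → All (Solves g) es) gens →
                 All (λ g → All (Solves g) ((p , q) ∷ es)) (cut gens)
    cut-solves {es} {gens} sol = All.++⁺
      (All.tabulate λ g∈ → let (g∈gens , eq) = ∈-filter⁻ (equal? P Q) {xs = gens} g∈ in
        eq ∷ All.lookup sol g∈gens)
      (All.cartesianProductWith⁺ (setoid _) (setoid _) combine (positives gens) (negatives gens)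
        λ {g} {h} g∈ h∈ →
        let (g∈gens , g⁺) = ∈-filter⁻ (greater? P Q) {xs = gens} g∈
            (h∈gens , h⁻) = ∈-filter⁻ (less? P Q) {xs = gens} h∈
        in combine-solves {g} {h} g⁺ h⁻ ∷
           All.zipWith (λ {e} (ge , he) → combine-preserves {g} {h} e ge he)
             (All.lookup sol g∈gens , All.lookup sol h∈gens))

    -- If z decomposes a solution, the positive and the negative excesses in z
    -- have the same sum U, and U · z = U · zeros + Σ combine g h over the
    -- positive g and the negative h in z.
    cut-decomposition : ∀ {gens ys} → Solves ys (p , q) →
                        Decomposition gens ys → Decomposition (cut gens) ys
    cut-decomposition {gens} {ys} solves (m , z , m≢0 , z⊆ , total-z) = result (total up z⁺) refl
      where
      z⁰ = zeros z
      z⁺ = positives z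
      z⁻ = negatives z

      -- `P` and `Q` agree on `z`, since both are `m` times their common value on `ys`. Cancelling
      -- the zero part and the smaller of the two weights on each side leaves the excesses.
      balance : total up z⁺ ≡ total down z⁻
      balance = +-cancelˡ-≡ (total Q z⁰ + (total Q z⁺ + total P z⁻)) _ _ (begin
        total Q z⁰ + (total Q z⁺ + total P z⁻) + total up z⁺
          ≡⟨ ring₁ (total Q z⁰) (total Q z⁺) (total P z⁻) _ ⟩
        total Q z⁰ + (total Q z⁺ + total up z⁺ + total P z⁻)
          ≡⟨ cong₂ (λ s t → s + (t + total P z⁻))
               (total-cong (All.all-filter (equal? P Q) z))
               (total-∸ (All.map <⇒≤ (All.all-filter (greater? P Q) z))) ⟨
        total P z⁰ + (total P z⁺ + total P z⁻)
          ≡⟨ total-split P Q P z ⟨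
        total P z
          ≡⟨ trans (total-z p) (trans (cong (m *_) solves) (sym (total-z q))) ⟩
        total Q z
          ≡⟨ total-split P Q Q z ⟩
        total Q z⁰ + (total Q z⁺ + total Q z⁻)
          ≡⟨ cong (λ t → total Q z⁰ + (total Q z⁺ + t))
               (total-∸ (All.map <⇒≤ (All.all-filter (less? P Q) z))) ⟩
        total Q z⁰ + (total Q z⁺ + (total P z⁻ + total down z⁻))
          ≡⟨ ring₂ (total Q z⁰) (total Q z⁺) (total P z⁻) _ ⟩
        total Q z⁰ + (total Q z⁺ + total P z⁻) + total down z⁻ ∎)
        where
        open ≡-Reasoning
        ring₁ : ∀ a b c d → a + (b + c) + d ≡ a + (b + d + c)
        ring₁ = solve-∀
        ring₂ : ∀ a b c d → a + (b + (c + d)) ≡ a + (b + c) + d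
        ring₂ = solve-∀

      part : ∀ {R : List A → Set} (R? : U.Decidable R) {g} → g ∈ filter R? z →
             (g ∈ filter R? gens) × (g ⊆ ys)
      part R? g∈ =
        let (g∈z , Rg) = ∈-filter⁻ R? {xs = z} g∈
            (g∈gens , g⊆) = All.lookup z⊆ g∈z
        in ∈-filter⁺ R? g∈gens Rg , g⊆

      zeros⊆ : All (λ g → g ∈ cut gens × g ⊆ ys) z⁰
      zeros⊆ = All.tabulate λ g∈ →
        let (g∈′ , g⊆) = part (equal? P Q) g∈ in ∈-++⁺ˡ g∈′ , g⊆

      pairs⊆ : All (λ g → g ∈ cut gens × g ⊆ ys) (cartesianProductWith combine z⁺ z⁻)
      pairs⊆ = All.cartesianProductWith⁺ (setoid _) (setoid _) combine z⁺ z⁻ λ {g} {h} g∈ h∈ →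
        let (g∈′ , g⊆) = part (greater? P Q) g∈
            (h∈′ , h⊆) = part (less? P Q) h∈
        in ∈-++⁺ʳ (zeros gens) (∈-cartesianProductWith⁺ combine g∈′ h∈′) ,
           All.lookup (All.++⁺ (All-· (down h) (All.tabulate g⊆)) (All-· (up g) (All.tabulate h⊆)))

      result : ∀ U → total up z⁺ ≡ U → Decomposition (cut gens) ys
      -- Zero cannot serve as a multiplier. But every element of `z⁺` and `z⁻` is strictly off the
      -- hyperplane, so both lists are empty and the zero part is all of `z`.
      result zero up≡0 = m , z⁰ , m≢0 , zeros⊆ , λ F → begin
        total (total F) z⁰                ≡⟨ +-identityʳ _ ⟨
        total (total F) z⁰ + (total (total F) [] + total (total F) [])
          ≡⟨ cong₂ (λ s t → total (total F) z⁰ + (total (total F) s + total (total F) t)) z⁺≡[] z⁻≡[] ⟨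
        total (total F) z⁰ + (total (total F) z⁺ + total (total F) z⁻)
                                          ≡⟨ total-split P Q (total F) z ⟨
        total (total F) z                 ≡⟨ total-z F ⟩
        m * total F ys                    ∎
        where
        open ≡-Reasoning
        z⁺≡[] : z⁺ ≡ []
        z⁺≡[] = total-positive up (All.map m<n⇒0<n∸m (All.all-filter (greater? P Q) z)) up≡0
        z⁻≡[] : z⁻ ≡ []
        z⁻≡[] = total-positive down (All.map m<n⇒0<n∸m (All.all-filter (less? P Q) z))
                  (trans (sym balance) up≡0)
      result U@(suc _) up≡U = U * m , U · z⁰ ++ cartesianProductWith combine z⁺ z⁻ ,
        m*n≢0 U m {{_}} {{m≢0}} , All.++⁺ (All-· U zeros⊆) pairs⊆ , λ F →
        let V = total F in begin
        total V (U · z⁰ ++ cartesianProductWith combine z⁺ z⁻)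
          ≡⟨ total-++ V (U · z⁰) _ ⟩
        total V (U · z⁰) + total V (cartesianProductWith combine z⁺ z⁻)
          ≡⟨ cong₂ _+_ (total-· V U z⁰)
               (total-cartesianProductWith {V = V} (total-combine F) z⁺ z⁻) ⟩
        U * total V z⁰ + (total down z⁻ * total V z⁺ + total up z⁺ * total V z⁻)
          ≡⟨ cong₂ (λ s t → U * total V z⁰ + (s * total V z⁺ + t * total V z⁻))
               (trans (sym balance) up≡U) up≡U ⟩
        U * total V z⁰ + (U * total V z⁺ + U * total V z⁻)
          ≡⟨ ring U (total V z⁰) (total V z⁺) (total V z⁻) ⟩
        U * (total V z⁰ + (total V z⁺ + total V z⁻))
          ≡⟨ cong (U *_) (total-split P Q V z) ⟨
        U * total V z
          ≡⟨ cong (U *_) (total-z F) ⟩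
        U * (m * total F ys)
          ≡⟨ *-assoc U m _ ⟨
        U * m * total F ys ∎
        where
        open ≡-Reasoning
        ring : ∀ U a b c → U * a + (U * b + U * c) ≡ U * (a + (b + c))
        ring = solve-∀

  -- Induction on the equations, with one cut for each; at the start a multiset is the sum of its
  -- own singletons. `gens` is fixed before `ys`, so finitely many generators serve all solutions.
  generators : ∀ (atoms : List A) es → ∃ λ gens → All (λ g → All (Solves g) es) gens ×
    (∀ ys → ys ⊆ atoms → All (Solves ys) es → Decomposition gens ys)
  generators atoms [] = map [_] atoms , All.universal (λ _ → []) _ , λ ys ys⊆ _ →
    1 , map [_] ys , _ ,
    All.map⁺ (All.tabulate λ y∈ → ∈-map⁺ [_] (ys⊆ y∈) , λ { (here refl) → y∈ }) ,
    λ F → trans (total-singletons F ys) (sym (*-identityˡ _))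
  generators atoms ((p , q) ∷ es) =
    let (gens , sol , decompose) = generators atoms es in
    cut gens , cut-solves sol , λ { ys ys⊆ (e ∷ solves) → cut-decomposition e (decompose ys ys⊆ solves) }
    where open Cut p q

-- Vertex subsets and incidence matrices

allSubsets : ∀ n → List (Subset n)
allSubsets zero    = [ Vec.[] ]
allSubsets (suc n) = map (inside Vec.∷_) (allSubsets n) ++ map (outside Vec.∷_) (allSubsets n)

∈-allSubsets : ∀ {n} (S : Subset n) → S ∈ allSubsets n
∈-allSubsets Vec.[]            = here refl
∈-allSubsets (inside  Vec.∷ S) = ∈-++⁺ˡ (∈-map⁺ _ (∈-allSubsets S))
∈-allSubsets (outside Vec.∷ S) = ∈-++⁺ʳ (map (inside Vec.∷_) _) (∈-map⁺ _ (∈-allSubsets S))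

indicator : Bool → ℕ
indicator true  = 1
indicator false = 0

cover : ∀ {n} → Fin n → Subset n → ℕ
cover v S = indicator (Vec.lookup S v)

cover-∅ : ∀ {n} (v : Fin n) → cover v ∅ ≡ 0
cover-∅ v = cong indicator (Vec.lookup-replicate v outside)

-- Transposition of an incidence matrix: it turns color sets of vertices into color classes, and
-- classes back into color sets.
column : ∀ {n k} → (Fin k → Subset n) → Fin n → Subset k
column S v = Vec.tabulate λ i → Vec.lookup (S i) v

∈-column⁺ : ∀ {n k} (S : Fin k → Subset n) {i v} → v ∈ₛ S i → i ∈ₛ column S v
∈-column⁺ S {i} v∈ =
  Vec.lookup⇒[]= i _ (trans (Vec.lookup∘tabulate _ i) (Vec.[]=⇒lookup v∈))

∈-column⁻ : ∀ {n k} (S : Fin k → Subset n) {i v} → i ∈ₛ column S v → v ∈ₛ S i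
∈-column⁻ S {i} {v} i∈ =
  Vec.lookup⇒[]= v _ (trans (sym (Vec.lookup∘tabulate _ i)) (Vec.[]=⇒lookup i∈))

∣column∣ : ∀ {n k} (S : Fin k → Subset n) v → ∣ column S v ∣ ≡ total (cover v) (tabulate S)
∣column∣ {k = zero}  S v = refl
∣column∣ {k = suc k} S v with Vec.lookup (S zero) v
... | inside  = cong suc (∣column∣ (S ∘ suc) v)
... | outside = ∣column∣ (S ∘ suc) v

column-column : ∀ {n k} (S : Fin k → Subset n) i → column (column S) i ≡ S i
column-column S i = trans
  (Vec.tabulate-cong λ v → Vec.lookup∘tabulate (λ i → Vec.lookup (S i) v) i)
  (Vec.tabulate∘lookup (S i))

-- Oriented colorings as lists of color classes

module _ (G : OrientedGraph) where

  -- Condition (ii) for one pair of colors, with `S` and `T` as their classes. For `S = T` and two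
  -- equal arcs it becomes condition (i), so compatibility of all pairs, the diagonal included,
  -- covers both.
  Compatible : Subset (order G) → Subset (order G) → Set
  Compatible S T = ∀ x y z w → Arc G x y → Arc G z w →
    ¬ (x ∈ₛ S × w ∈ₛ S × y ∈ₛ T × z ∈ₛ T)

  compatible? : ∀ S T → Dec (Compatible S T)
  compatible? S T = all? λ x → all? λ y → all? λ z → all? λ w →
    arc? G x y →-dec arc? G z w →-dec
    ¬? (x ∈? S ×-dec w ∈? S ×-dec y ∈? T ×-dec z ∈? T)

  PairwiseCompatible : List (Subset (order G)) → Set
  PairwiseCompatible Ss = All (λ S → All (Compatible S) Ss) Ss

  pairwiseCompatible? : U.Decidable PairwiseCompatible
  pairwiseCompatible? Ss = All.all? (λ S → All.all? (compatible? S) Ss) Ss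

  -- Compatibility ignores multiplicities, so it survives both passing to a multiset contained in a
  -- coloring and repeating classes.
  PairwiseCompatible-anti : ∀ {Ss Ts} → Ss ⊆ Ts → PairwiseCompatible Ts → PairwiseCompatible Ss
  PairwiseCompatible-anti Ss⊆Ts comp =
    All.map (All.anti-mono Ss⊆Ts) (All.anti-mono Ss⊆Ts comp)

  -- A b-fold oriented coloring, presented by its list of color classes.
  Classes : ℕ → List (Subset (order G)) → Set
  Classes b Ss = (∀ v → total (cover v) Ss ≡ b) × PairwiseCompatible Ss

  coloring⇒classes : ∀ {b k} → Colorable G b k → ∃ λ Ss → length Ss ≡ k × Classes b Ss
  coloring⇒classes (f , col) = tabulate class , length-tabulate class ,
    (λ v → trans (sym (∣column∣ class v))
       (trans (cong ∣_∣ (column-column (proj₁ ∘ f) v)) (proj₂ (f v)))) ,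
    All.tabulate⁺ λ i → All.tabulate⁺ λ j x y z w xy zw (x∈ , w∈ , y∈ , z∈) →
      IsColoring.consistent col xy zw
        (i , x∈p∩q⁺ (color x∈ , color w∈)) (j , x∈p∩q⁺ (color y∈ , color z∈))
    where
    class = column (proj₁ ∘ f)
    color : ∀ {i v} → v ∈ₛ class i → i ∈ₛ proj₁ (f v)
    color = ∈-column⁻ (proj₁ ∘ f)

  classes⇒coloring : ∀ {b Ss} → Classes b Ss → Colorable G b (length Ss)
  classes⇒coloring {b} {Ss} (covers , comp) = f , record
    { proper     = λ {x} {y} xy (i , i∈) →
        let (x∈ , y∈) = both x y i∈ in apart i i x y x y xy xy (x∈ , y∈ , y∈ , x∈)
    ; consistent = λ {x} {y} {z} {w} xy zw (i , i∈) (j , j∈) →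
        let (x∈ , w∈) = both x w i∈
            (y∈ , z∈) = both y z j∈
        in apart i j x y z w xy zw (x∈ , w∈ , y∈ , z∈)
    }
    where
    f : Vertex G → 𝒫 b (length Ss)
    f v = column (lookup Ss) v , (begin
      ∣ column (lookup Ss) v ∣                ≡⟨ ∣column∣ (lookup Ss) v ⟩
      total (cover v) (tabulate (lookup Ss))  ≡⟨ cong (total (cover v)) (tabulate-lookup Ss) ⟩
      total (cover v) Ss                      ≡⟨ covers v ⟩
      b                                       ∎)
      where open ≡-Reasoning
    apart : ∀ i j → Compatible (lookup Ss i) (lookup Ss j)
    apart i j = All.lookup (All.lookup comp (∈-lookup i)) (∈-lookup j)
    both : ∀ x y {i} → i ∈ₛ proj₁ (f x) ∩ proj₁ (f y) → x ∈ₛ lookup Ss i × y ∈ₛ lookup Ss i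
    both x y i∈ = let (ix , iy) = x∈p∩q⁻ _ _ i∈ in
      ∈-column⁻ (lookup Ss) ix , ∈-column⁻ (lookup Ss) iy

  blow-up : ∀ {n a Ss} b → b * length Ss ≤ a → Classes n Ss → Colorable G (b * n) a
  blow-up {n} {a} {Ss} b ≤a (covers , comp) =
    subst (Colorable G (b * n)) length-Ts (classes⇒coloring (covers′ , comp′))
    where
    r = a ∸ b * length Ss
    -- The `r` empty classes bring the number of colors up to exactly `a`; they cover no vertex and
    -- are compatible with every class.
    Ts = b · Ss ++ r · [ ∅ ]
    total-Ts : ∀ F → total F Ts ≡ b * total F Ss + r * (F ∅ + 0)
    total-Ts F = trans (total-++ F (b · Ss) _) (cong₂ _+_ (total-· F b Ss) (total-· F r [ ∅ ]))
    length-Ts : length Ts ≡ a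
    length-Ts = begin
      length Ts                            ≡⟨ total≡length Ts ⟨
      total (const 1) Ts                   ≡⟨ total-Ts (const 1) ⟩
      b * total (const 1) Ss + r * 1       ≡⟨ cong₂ (λ s t → b * s + t) (total≡length Ss) (*-identityʳ r) ⟩
      b * length Ss + r                    ≡⟨ m+[n∸m]≡n ≤a ⟩
      a                                    ∎
      where open ≡-Reasoning
    covers′ : ∀ v → total (cover v) Ts ≡ b * n
    covers′ v = begin
      total (cover v) Ts                              ≡⟨ total-Ts (cover v) ⟩
      b * total (cover v) Ss + r * (cover v ∅ + 0)    ≡⟨ cong₂ (λ s t → b * s + r * (t + 0)) (covers v) (cover-∅ v) ⟩
      b * n + r * 0                                   ≡⟨ cong (_+_ (b * n)) (*-zeroʳ r) ⟩
      b * n + 0                                       ≡⟨ +-identityʳ _ ⟩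
      b * n                                           ∎
      where open ≡-Reasoning
    padded : PairwiseCompatible (∅ ∷ Ss)
    padded =
      All.universal (λ _ _ _ _ _ _ _ (x∈ , _) → ∉⊥ x∈) _ ∷
      All.map ((λ _ _ _ _ _ _ (_ , _ , y∈ , _) → ∉⊥ y∈) ∷_) comp
    comp′ : PairwiseCompatible Ts
    comp′ = PairwiseCompatible-anti (All.lookup (All.++⁺
      (All-· b (All.tabulate there)) (All-· r (here refl ∷ [])))) padded

  -- Either the ratio is attained or there is a gap

  module _ (a b : ℕ) where

    -- The ratio bound `length Ss / n ≤ a / b` with denominators cleared.
    Attained : Set
    Attained = ∃₂ λ n Ss → 0 < n × b * length Ss ≤ a * n × Classes n Ss

    -- For positive `n`, `b` and `B` the inequality says that `length Ss / n` is at least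
    -- `(a + 1 / B) / b`, a fixed gap above `a / b`.
    Separated : ℕ → Set
    Separated B = ∀ n Ss → Classes n Ss → n + B * (a * n) ≤ B * (b * length Ss)

    -- For a vertex v₀, the color classes of the colorings are the pairwise
    -- compatible solutions of the equations cover v = cover v₀.
    attained⊎separated-at : Vertex G → Attained ⊎ ∃ λ B → Separated (suc B)
    attained⊎separated-at v₀ = decide (Any.any? good? gens)
      where
      equations : List Equation
      equations = map (λ v → cover v , cover v₀) (allFin (order G))

      gens = proj₁ (generators (allSubsets (order G)) equations)
      gens-solve = proj₁ (proj₂ (generators (allSubsets (order G)) equations))
      decompose = proj₂ (proj₂ (generators (allSubsets (order G)) equations))

      N K : List (Subset (order G)) → ℕ
      N = total (cover v₀)
      K = total (const 1)

      Good : List (Subset (order G)) → Set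
      Good g = PairwiseCompatible g × 0 < N g × b * length g ≤ a * N g

      good? : U.Decidable Good
      good? g = pairwiseCompatible? g ×-dec 0 <? N g ×-dec b * length g ≤? a * N g

      -- Large enough that `N g ≤ B` for every generator, which makes the gap uniform.
      B = suc (total N gens)

      -- The inequality is linear in `N` and `K`, hence additive over the pieces of a decomposition.
      bound-total : ∀ {z} → All (λ g → N g + B * (a * N g) ≤ B * (b * K g)) z →
                    total N z + B * (a * total N z) ≤ B * (b * total K z)
      bound-total [] = ≤-reflexive (trans (cong (B *_) (*-zeroʳ a)) (cong (B *_) (sym (*-zeroʳ b))))
      bound-total {g ∷ z} (le ∷ les) = begin
        N g + total N z + B * (a * (N g + total N z))
          ≡⟨ ring₁ (N g) (total N z) B a ⟩
        N g + B * (a * N g) + (total N z + B * (a * total N z))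
          ≤⟨ +-mono-≤ le (bound-total les) ⟩
        B * (b * K g) + B * (b * total K z)
          ≡⟨ ring₂ B b (K g) (total K z) ⟩
        B * (b * (K g + total K z)) ∎
        where
        open ≤-Reasoning
        ring₁ : ∀ n m B a → n + m + B * (a * (n + m)) ≡ n + B * (a * n) + (m + B * (a * m))
        ring₁ = solve-∀
        ring₂ : ∀ B b k l → B * (b * k) + B * (b * l) ≡ B * (b * (k + l))
        ring₂ = solve-∀

      -- If `0 < N g`, the ratio test fails by at least one unit, by integrality; multiplied by `B`,
      -- that unit pays for `N g`. If `N g` is zero, the left side vanishes.
      bound-generator : ∀ {g} → g ∈ gens → PairwiseCompatible g → ¬ Good g →
                        N g + B * (a * N g) ≤ B * (b * K g)
      bound-generator {g} g∈ comp ¬good with 0 <? N g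
      ... | no  0≮N = subst (λ n → n + B * (a * n) ≤ B * (b * K g)) (sym (n≤0⇒n≡0 (≮⇒≥ 0≮N)))
        (≤-trans (≤-reflexive (trans (cong (B *_) (*-zeroʳ a)) (*-zeroʳ B))) z≤n)
      ... | yes 0<N = begin
        N g + B * (a * N g)    ≤⟨ +-monoˡ-≤ _ (m≤n⇒m≤1+n (≤total N g∈)) ⟩
        B + B * (a * N g)      ≡⟨ *-suc B _ ⟨
        B * suc (a * N g)      ≤⟨ *-monoʳ-≤ B (≰⇒> λ le → ¬good (comp , 0<N ,
                                    subst (λ k → b * k ≤ a * N g) (total≡length g) le)) ⟩
        B * (b * K g)          ∎
        where open ≤-Reasoning

      decide : Dec (Any.Any Good gens) → Attained ⊎ ∃ λ B → Separated (suc B)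
      decide (yes any) with find any
      -- The equations make `g` cover every vertex `N g` times, so `g` is itself an `N g`-fold
      -- coloring.
      ... | g , g∈ , comp , 0<N , le = inj₁ (N g , g , 0<N , le ,
        (λ v → All.lookup (All.map⁻ (All.lookup gens-solve g∈)) (∈-allFin v)) , comp)
      decide (no ¬any) = inj₂ (total N gens , separated)
        where
        separated : Separated B
        separated n Ss (covers , comp)
          with decompose Ss (λ _ → ∈-allSubsets _)
                 (All.map⁺ (All.universal (λ v → trans (covers v) (sym (covers v₀))) _))
        -- The pieces in `z` sum to `m` copies of `Ss`, so the bound for `z` is `m` times the
        -- desired one.
        ... | m , z , m≢0 , z⊆ , total-z = *-cancelˡ-≤ m {{m≢0}} (begin
          m * (n + B * (a * n))                    ≡⟨ ring₁ m n B a ⟩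
          m * n + B * (a * (m * n))                ≡⟨ cong (λ t → t + B * (a * t)) N-z ⟨
          total N z + B * (a * total N z)          ≤⟨ bound-total (All.map bound z⊆) ⟩
          B * (b * total K z)                      ≡⟨ cong (λ t → B * (b * t)) K-z ⟩
          B * (b * (m * length Ss))                ≡⟨ ring₂ B b m (length Ss) ⟩
          m * (B * (b * length Ss))                ∎)
          where
          open ≤-Reasoning
          ring₁ : ∀ m n B a → m * (n + B * (a * n)) ≡ m * n + B * (a * (m * n))
          ring₁ = solve-∀
          ring₂ : ∀ B b m k → B * (b * (m * k)) ≡ m * (B * (b * k))
          ring₂ = solve-∀
          N-z : total N z ≡ m * n
          N-z = trans (total-z (cover v₀)) (cong (m *_) (covers v₀))
          K-z : total K z ≡ m * length Ss
          K-z = trans (total-z (const 1)) (cong (m *_) (total≡length Ss))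
          -- A piece lies within `Ss` and inherits its compatibility, so `bound-generator` applies.
          bound : ∀ {g} → g ∈ gens × g ⊆ Ss → N g + B * (a * N g) ≤ B * (b * K g)
          bound (g∈ , g⊆) = bound-generator g∈ (PairwiseCompatible-anti g⊆ comp)
            λ good → ¬any (Any.map (λ { refl → good }) g∈)

    attained⊎separated : Attained ⊎ ∃ λ B → Separated (suc B)
    attained⊎separated with any? {n = order G} (λ _ → yes tt)
    ... | yes (v₀ , _) = attained⊎separated-at v₀
    -- Without vertices the empty list of classes is vacuously a 1-fold coloring with no colors.
    ... | no  empty    = inj₁ (1 , [] , s≤s z≤n , ≤-trans (≤-reflexive (*-zeroʳ b)) z≤n ,
      (λ v → contradiction (v , tt) empty) , [])

-- Colorings as homomorphisms to consistent sub-orientations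

lookup-injective : ∀ {A : Set} {xs : List A} → Unique xs → Injective _≡_ _≡_ (lookup xs)
lookup-injective (x∉ ∷ u) {zero}  {zero}  e = refl
lookup-injective (x∉ ∷ u) {zero}  {suc j} e = contradiction e (All.lookup x∉ (∈-lookup j))
lookup-injective (x∉ ∷ u) {suc i} {zero}  e = contradiction (sym e) (All.lookup x∉ (∈-lookup i))
lookup-injective (x∉ ∷ u) {suc i} {suc j} e = cong suc (lookup-injective u e)

_≟𝒫_ : ∀ {b k} → DecidableEquality (𝒫 b k)
(p , refl) ≟𝒫 (q , e) with Vec.≡-dec Bool._≟_ p q
... | no p≢q   = no λ { refl → p≢q refl }
... | yes refl = yes (cong (p ,_) (≡-irrelevant refl e))

-- A set disjoint from itself is empty, against `b` being nonzero. This turns disjointness and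
-- consistency into the absence of loops and 2-cycles.
meets-self : ∀ {b k} .{{_ : NonZero b}} (p : 𝒫 b k) → Meets p p
meets-self {b} {k} (p , e) with nonempty? (p ∩ p)
... | yes m = m
... | no ¬m = contradiction
  (trans (sym e) (trans (cong ∣_∣ (trans (sym (∩-idem p)) (Empty-unique ¬m))) (∣⊥∣≡0 k)))
  (≢-nonZero⁻¹ b)

-- The image of f, deduplicated since f need not be injective but ι must be.
coloring⇒sub-orientation : ∀ G {a b} .{{_ : NonZero b}} → Colorable G b a →
  Σ (ConsistentSubOrientation a b) λ H → Homomorphism G (ConsistentSubOrientation.graph H)
coloring⇒sub-orientation G {a} {b} (f , col) = H , φ , λ xy → _ , _ , xy , refl , refl
  where
  open IsColoring col
  image = deduplicate _≟𝒫_ (tabulate f)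

  φ : Vertex G → Fin (length image)
  φ v = index (∈-deduplicate⁺ _≟𝒫_ (∈-tabulate⁺ {f = f} v))

  lookup-φ : ∀ v → f v ≡ lookup image (φ v)
  lookup-φ v = lookup-index (∈-deduplicate⁺ _≟𝒫_ (∈-tabulate⁺ {f = f} v))

  -- Only images of arcs of `G` are arcs, so every condition on arcs reduces to the coloring
  -- conditions at preimages.
  _⟶_ : Fin (length image) → Fin (length image) → Set
  i ⟶ j = ∃₂ λ x y → Arc G x y × φ x ≡ i × φ y ≡ j

  disjoint : ∀ {i j} → i ⟶ j → Disjoint (lookup image i) (lookup image j)
  disjoint (x , y , xy , refl , refl) =
    subst₂ Disjoint (lookup-φ x) (lookup-φ y) (proper xy)

  consistent′ : ∀ {i j k l} → i ⟶ j → k ⟶ l →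
    Meets (lookup image i) (lookup image l) → Disjoint (lookup image j) (lookup image k)
  consistent′ (x , y , xy , refl , refl) (z , w , zw , refl , refl) m =
    subst₂ Disjoint (lookup-φ y) (lookup-φ z)
      (consistent xy zw (subst₂ Meets (sym (lookup-φ x)) (sym (lookup-φ w)) m))

  H : ConsistentSubOrientation a b
  H = record
    { graph = record
      { order     = length image
      ; Arc       = _⟶_
      ; arc?      = λ i j → any? λ x → any? λ y →
          arc? G x y ×-dec φ x Fin.≟ i ×-dec φ y Fin.≟ j
      ; no-loop   = λ {i} ii → disjoint ii (meets-self (lookup image i))
      -- Since the set of `i` meets itself, consistency of the two opposite arcs would make the set
      -- of `j` disjoint from itself.
      ; no-2cycle = λ {i} {j} ij ji →
          consistent′ ij ji (meets-self (lookup image i)) (meets-self (lookup image j))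
      }
    ; embedding = record
      { ι         = lookup image
      ; injective = lookup-injective (Unique.deduplicate-! _≟𝒫_ (tabulate f))
      ; adjacent  = λ
          { (inj₁ ij) → disjoint ij
          ; {i} {j} (inj₂ ji) m → disjoint ji
              (subst (Nonempty) (∩-comm (proj₁ (lookup image i)) (proj₁ (lookup image j))) m)
          }
      }
    ; consistent = consistent′
    }

-- The inclusion `ι` satisfies both coloring conditions on the arcs of `H`, and these pull back
-- along a homomorphism.
sub-orientation⇒coloring : ∀ G {a b} (H : ConsistentSubOrientation a b) →
  Homomorphism G (ConsistentSubOrientation.graph H) → Colorable G b a
sub-orientation⇒coloring G H (φ , hom) = ι ∘ φ , record
  { proper     = λ xy → adjacent (inj₁ (hom xy))
  ; consistent = λ xy zw → consistent (hom xy) (hom zw)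
  }
  where open ConsistentSubOrientation H

-- Comparison of fractions and the equivalence

/-mono-≤ : ∀ {m n p q} → m * suc q ≤ p * suc n → + m / suc n ℚ.≤ + p / suc q
/-mono-≤ {m} {n} {p} {q} le = *≤* (subst₂ ℤ._≤_ (ℤ.pos-* m (suc q)) (ℤ.pos-* p (suc n)) (ℤ.+≤+ le))

/-mono-< : ∀ {m n p q} → m * suc q < p * suc n → + m / suc n ℚ.< + p / suc q
/-mono-< {m} {n} {p} {q} lt = *<* (subst₂ ℤ._<_ (ℤ.pos-* m (suc q)) (ℤ.pos-* p (suc n)) (ℤ.+<+ lt))

/-cancel-< : ∀ {m n p q} → + m / suc n ℚ.< + p / suc q → m * suc q < p * suc n
/-cancel-< {m} {n} {p} {q} (*<* lt) =
  ℤ.drop‿+<+ (subst₂ ℤ._<_ (sym (ℤ.pos-* m (suc q))) (sym (ℤ.pos-* p (suc n))) lt)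

-- A separation constant B makes (1 + B a) / (B b) > a / b a lower bound of
-- all the ratios χ[ n ] G / n.
¬separated : ∀ G a b B → χ* G ≤ℝᵘ fromℚ (+ a / suc b) → ¬ Separated G a (suc b) (suc B)
¬separated G a b B χ≤ separated
  with χ≤ (+ suc (suc B * a) / (suc B * suc b))
         (/-mono-< (subst (_< suc (suc B * a) * suc b) 
           (trans (cong (_* suc b) (*-comm (suc B) a)) (*-assoc a (suc B) (suc b)))
           (*-monoˡ-< (suc b) (n<1+n (suc B * a)))))
... | m , χ< with coloring⇒classes G (proj₁ (χ-isMinimum (suc m) G))
... | Ss , len , classes = <-irrefl refl (begin-strict
  χ[ n ] G * (suc B * suc b)         <⟨ /-cancel-< χ< ⟩
  suc (suc B * a) * n                ≡⟨ ring₁ (suc B) a n ⟩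
  n + suc B * (a * n)                ≤⟨ separated n Ss classes ⟩
  suc B * (suc b * length Ss)        ≡⟨ cong (λ k → suc B * (suc b * k)) len ⟩
  suc B * (suc b * χ[ n ] G)         ≡⟨ ring₂ (suc B) (suc b) (χ[ n ] G) ⟩
  χ[ n ] G * (suc B * suc b)         ∎)
  where
  open ≤-Reasoning
  n = suc m
  ring₁ : ∀ B a n → suc (B * a) * n ≡ n + B * (a * n)
  ring₁ = solve-∀
  ring₂ : ∀ B b k → B * (b * k) ≡ k * (B * b)
  ring₂ = solve-∀

theorem1 : (G : OrientedGraph) (a b : ℕ) .{{_ : NonZero a}} .{{_ : NonZero b}} →
    (χ* G ≤ℝᵘ fromℚ (+ a / b)) ⇔
    (∃ λ (c : ℕ) → NonZero c ×
    (Σ (ConsistentSubOrientation (a * c) (b * c)) λ H →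
    Homomorphism G (ConsistentSubOrientation.graph H)))
theorem1 G a b@(suc b-1) = mk⇔ to from
  where
  to : χ* G ≤ℝᵘ fromℚ (+ a / b) → ∃ λ c → NonZero c ×
       (Σ (ConsistentSubOrientation (a * c) (b * c)) λ H →
        Homomorphism G (ConsistentSubOrientation.graph H))
  to χ≤ with attained⊎separated G a b
  ... | inj₂ (B , separated) = contradiction separated (¬separated G a b-1 B χ≤)
  -- The multiplier `c` is the fold `n`: repeating each class `b` times gives `b * n` colors per
  -- vertex, out of `a * n` after padding.
  ... | inj₁ (n@(suc _) , Ss , _ , b∣Ss∣≤an , classes) =
    n , _ , coloring⇒sub-orientation G (blow-up G b b∣Ss∣≤an classes)

  from : (∃ λ c → NonZero c × (Σ (ConsistentSubOrientation (a * c) (b * c)) λ H →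
          Homomorphism G (ConsistentSubOrientation.graph H))) → χ* G ≤ℝᵘ fromℚ (+ a / b)
  from (zero , record { nonZero = () } , _)
  -- An index `k` of the infimum stands for the fold `suc k`; the successor of this one computes to
  -- `b * c`.
  from (c@(suc c-1) , _ , H , hom) q a/b<q = c-1 + b-1 * c ,
    ℚ.≤-<-trans (/-mono-≤ (begin
      χ[ b * c ] G * b    ≤⟨ *-monoˡ-≤ b (proj₂ (χ-isMinimum (b * c) G) (a * c)
                                (sub-orientation⇒coloring G H hom)) ⟩
      a * c * b           ≡⟨ ring a b c ⟩
      a * (b * c)         ∎)) a/b<q
    where
    open ≤-Reasoning
    ring : ∀ a b c → a * c * b ≡ a * (b * c)
    ring = solve-∀
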